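{- Let $n\geq 3$ be an integer and $p$ a prime with $\gcd(n,p(p-1))=1$. Let $F(x_1,\ldots,x_r)=a_1x_1^n+a_2x_2^n+\cdots+a_rx_r^n$ with $a_1,\ldots,a_r$ integers such that $r>\frac{n}{2}$, $a_1a_2\cdots a_r\neq 0$, and $\nu_p(a_i)\not\equiv\nu_p(a_j)\pmod n$ for all $1\leq i<j\leq r$. Then $R(F)$ is dense in $\mathbb{Q}_p$.
   Context: For an integral form $F$ in $r$ variables, $R(F)=\{F(\overline{x})/F(\overline{y}):\overline{x},\overline{y}\in\mathbb{Z}^r,\ F(\overline{y})\neq 0\}$, viewed as a subset of the field $\mathbb{Q}_p$ of $p$-adic numbers with its $p$-adic topology. $\nu_p$ denotes the $p$-adic valuation. -}

module Defs where

open import Data.Bool.Base using (if_then_else_)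
open import Data.Integer.Base as ℤ using (ℤ; +_; ∣_∣; 0ℤ; 1ℤ)
import Data.Integer.Divisibility as ℤ
open import Data.Nat.Base as ℕ using (ℕ; zero; suc)
open import Data.Nat.Divisibility using (_∣?_)
open import Data.Product.Base using (Σ; ∃-syntax; _×_; _,_)
open import Data.Rational.Unnormalised.Base as ℚᵘ
  using (ℚᵘ; _/_; _÷_; _-_; ↥_; ↧ₙ_; 0ℚᵘ; _≄_)
import Data.Rational.Unnormalised.Properties as ℚᵘ
open import Data.Vec.Functional using (Vector; foldr)
open import Level using (0ℓ)
open import Relation.Binary.PropositionalEquality.Core using (_≢_)
open import Relation.Nullary using (does)
open import Relation.Unary using (Pred; _∈_)
open import Relation.Nullary.Negation using (contradiction)

infix 4 _≡_[mod_] _≤ν[_]_ _≈[_]_ _≈ₚ_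

∑ ∏ : ∀ {r} → Vector ℤ r → ℤ
∑ = foldr ℤ._+_ 0ℤ
∏ = foldr ℤ._*_ 1ℤ

_≡_[mod_] : ℤ → ℤ → ℕ → Set
i ≡ j [mod n ] = + n ℤ.∣ i ℤ.- j

-- The largest k ≤ b with p ^ k dividing m.
maxExponent : (p m b : ℕ) → ℕ
maxExponent p m zero    = zero
maxExponent p m (suc b) =
  if does (p ℕ.^ suc b ∣? m) then suc b else maxExponent p m b

-- The p-adic valuation of a nonzero integer (the value at 0 is junk).  For
-- p ≥ 2 and i ≢ 0, p ^ k ∣ i forces k < p ^ k ≤ ∣ i ∣, so searching up to
-- ∣ i ∣ misses no exponent.
ν : ℕ → ℤ → ℕ
ν p i = maxExponent p ∣ i ∣ ∣ i ∣

-- The p-adic valuation of a nonzero rational; for prime p it does not depend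
-- on the fraction representing it.
νℚ : ℕ → ℚᵘ → ℤ
νℚ p q = + ν p (↥ q) ℤ.- + ν p (+ (↧ₙ q))

-- k ≤ν[ p ] q says that the valuation of q is at least k, with ν(0) = ∞;
-- equivalently, the p-adic absolute value of q is at most p ^ (- k).
_≤ν[_]_ : ℕ → ℕ → ℚᵘ → Set
k ≤ν[ p ] q = q ≄ 0ℚᵘ → + k ℤ.≤ νℚ p q

-- ℚ_p as the completion of ℚ for the p-adic absolute value: Cauchy sequences
-- of rationals, with the setoid equality _≈ₚ_ below.
record ℚₚ (p : ℕ) : Set where
  field
    seq    : ℕ → ℚᵘ
    cauchy : ∀ k → ∃[ N ] (∀ l m → N ℕ.≤ l → N ℕ.≤ m →
                             k ≤ν[ p ] (seq l - seq m))

open ℚₚ public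

-- The p-adic distance between α and β is at most p ^ (- k).  As {q : ν(q) ≥ k}
-- is open and closed, this is the same as the bound on almost all terms.
_≈[_]_ : ∀ {p} → ℚₚ p → ℕ → ℚₚ p → Set
_≈[_]_ {p} α k β = ∃[ N ] (∀ m → N ℕ.≤ m → k ≤ν[ p ] (seq α m - seq β m))

_≈ₚ_ : ∀ {p} → ℚₚ p → ℚₚ p → Set
α ≈ₚ β = ∀ k → α ≈[ k ] β

ι : ∀ p → ℚᵘ → ℚₚ p
ι p q = record
  { seq    = λ _ → q
  ; cauchy = λ k → 0 , λ _ _ _ _ q-q≄0 → contradiction (ℚᵘ.+-inverseʳ q) q-q≄0
  }

-- The balls of radius p ^ (- k), k ∈ ℕ, form a base of the p-adic topology.
DenseInℚₚ : ∀ p → Pred (ℚₚ p) 0ℓ → Set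
DenseInℚₚ p S = ∀ (α : ℚₚ p) (k : ℕ) → ∃[ β ] (β ∈ S × α ≈[ k ] β)

quotient : (i j : ℤ) → j ≢ 0ℤ → ℚᵘ
quotient i j j≢0 = _÷_ (i / 1) (j / 1) {{ℤ.≢-nonZero j≢0}}

-- The ratio set R(F), as a subset of ℚ_p.
R : ∀ p {r} → (Vector ℤ r → ℤ) → Pred (ℚₚ p) 0ℓ
R p {r} F α = ∃[ x ] ∃[ y ] Σ (F y ≢ 0ℤ) λ Fy≢0 →
  α ≈ₚ ι p (quotient (F x) (F y) Fy≢0)

diagonalForm : ℕ → ∀ {r} → Vector ℤ r → Vector ℤ r → ℤ
diagonalForm n a x = ∑ (λ i → a i ℤ.* x i ℤ.^ n)

{-# OPTIONS --safe #-}

-- Since n is prime to p (p - 1), raising to the n-th power permutes the units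
-- modulo every p ^ M; hence a_i x ^ n / (a_j y ^ n), with x and y ranging over
-- p-powers times units, approximates every rational whose valuation is
-- congruent to ν (a_i) - ν (a_j) modulo n.  The r > n / 2 residues ν (a_i) are
-- distinct, so by pigeonhole their differences cover all residues modulo n.
-- Finally, a term of a Cauchy sequence far enough out replaces its p-adic limit.
module Submission where

open import Defs
open import Data.Fin.Base as Fin using (Fin; toℕ; fromℕ; inject₁)
import Data.Fin.Properties as Fin
open import Data.Integer.Base as ℤ
  using (ℤ; +_; -[1+_]; ∣_∣; 0ℤ; 1ℤ; _+_; _*_; _-_; -_; _^_)
import Data.Integer.Properties as ℤ
open import Data.Integer.DivMod using (_%ℕ_; _/ℕ_; a≡a%ℕn+[a/ℕn]*n)
open import Data.Integer.Divisibility.Signed as ∣ₛ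
  using (_∣_; divides; ∣ᵤ⇒∣; ∣⇒∣ᵤ; ∣n⇒∣m*n; ∣m⇒∣m*n; ∣m∣n⇒∣m+n)
open import Data.Integer.Tactic.RingSolver using (solve-∀)
open import Data.Nat.Base as ℕ using (ℕ; zero; suc; _∸_)
import Data.Nat.Properties as ℕ
open import Data.Nat.Combinatorics
  using (_C_; nCk≡n!/k![n-k]!; k![n∸k]!∣n!; nCn≡1)
open import Data.Nat.Coprimality as Coprime
  using (Coprime; coprime-divisor; coprime-Bézout; gcd≡1⇒coprime)
open import Data.Nat.Divisibility as ℕ∣ using (_∣?_)
open import Data.Nat.DivMod using (_%_; _/_; m/n*n≡m; m%n<n; m≡m%n+[m/n]*n)
open import Data.Nat.GCD using (gcd; module Bézout)
open import Data.Nat.Primality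
  using (Prime; euclidsLemma; prime⇒irreducible; prime⇒nonTrivial; prime⇒nonZero)
open import Data.Product.Base using (∃-syntax; ∃₂; _×_; _,_; proj₁)
open import Data.Rational.Unnormalised.Base as ℚᵘ
  using (ℚᵘ; mkℚᵘ; ↥_; ↧_; 0ℚᵘ; _≃_; *≡*)
import Data.Rational.Unnormalised.Properties as ℚᵘ
open import Data.Sum.Base using (_⊎_; inj₁; inj₂; [_,_]′)
open import Data.Vec.Functional using (Vector; _∷_; replicate)
open import Function.Base using (_∘_; id)
open import Relation.Binary.Definitions using (tri<; tri≈; tri>)
open import Relation.Binary.PropositionalEquality
open import Relation.Nullary using (¬_; contradiction; yes; no)

import Algebra.Definitions.RawSemiring ℤ.+-*-rawSemiring as Exp
import Algebra.Properties.CommutativeSemiring.Binomial ℤ.+-*-commutativeSemiring as Binomial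
import Algebra.Properties.Monoid.Sum ℤ.+-0-monoid as Sum

-- Congruences, coprimality and powers of integers.

congr-trans : ∀ {m} x {y z} → m ∣ x - y → m ∣ y - z → m ∣ x - z
congr-trans {m} x {y} {z} h k = subst (m ∣_) (lemma x y z) (∣m∣n⇒∣m+n h k)
  where
  lemma : ∀ x y z → (x - y) + (y - z) ≡ x - z
  lemma = solve-∀

congr-sym : ∀ {m} x {y} → m ∣ x - y → m ∣ y - x
congr-sym {m} x {y} h = subst (m ∣_) (lemma x y) (∣ₛ.∣m⇒∣-m h)
  where
  lemma : ∀ x y → - (x - y) ≡ y - x
  lemma = solve-∀

congr-* : ∀ {m} x {y} z {w} → m ∣ x - y → m ∣ z - w → m ∣ x * z - y * w
congr-* {m} x {y} z {w} h k =
  subst (m ∣_) (lemma x y z w) (∣m∣n⇒∣m+n (∣n⇒∣m*n z h) (∣n⇒∣m*n y k))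
  where
  lemma : ∀ x y z w → z * (x - y) + y * (z - w) ≡ x * z - y * w
  lemma = solve-∀

congr-refl : ∀ {m} x → m ∣ x - x
congr-refl {m} x = subst (m ∣_) (sym (ℤ.+-inverseʳ x)) (divides 0ℤ refl)

congr-^ : ∀ {m} x {y} k → m ∣ x - y → m ∣ x ^ k - y ^ k
congr-^ x zero    h = congr-refl 1ℤ
congr-^ x (suc k) h = congr-* x (x ^ k) h (congr-^ x k h)

^-distribʳ-* : ∀ x y k → (x * y) ^ k ≡ x ^ k * y ^ k
^-distribʳ-* x y zero    = refl
^-distribʳ-* x y (suc k) = trans (cong (x * y *_) (^-distribʳ-* x y k))
  (lemma x y (x ^ k) (y ^ k))
  where
  lemma : ∀ x y z w → x * y * (z * w) ≡ x * z * (y * w)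
  lemma = solve-∀

pos-^ : ∀ p k → + (p ℕ.^ k) ≡ (+ p) ^ k
pos-^ p zero    = refl
pos-^ p (suc k) = trans (ℤ.pos-* p (p ℕ.^ k)) (cong (+ p *_) (pos-^ p k))

coprime-* : ∀ {a b c} → Coprime a b → Coprime a c → Coprime a (b ℕ.* c)
coprime-* a⊥b a⊥c (d∣a , d∣bc) = a⊥c (d∣a , coprime-divisor
  (λ (e∣d , e∣b) → a⊥b (ℕ∣.∣-trans e∣d d∣a , e∣b)) d∣bc)

coprime-^ : ∀ {a b} k → Coprime a b → Coprime a (b ℕ.^ k)
coprime-^ zero    a⊥b = Coprime.sym (Coprime.1-coprimeTo _)
coprime-^ (suc k) a⊥b = coprime-* a⊥b (coprime-^ k a⊥b)

-- The binomial theorem is stated with the generic semiring operations `Exp.×` and `Exp.^`; this and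
-- `^≡^` turn its terms into ordinary integer products and powers.
×≡* : ∀ n x → n Exp.× x ≡ + n * x
×≡* zero    x = refl
×≡* (suc n) x = trans (cong (λ y → x + y) (×≡* n x)) (sym (ℤ.suc-* (+ n) x))

^≡^ : ∀ x n → x Exp.^ n ≡ x ^ n
^≡^ x zero    = refl
^≡^ x (suc n) = cong (x *_) (^≡^ x n)

∣sum : ∀ {m k} (t : Vector ℤ k) → (∀ i → m ∣ t i) → m ∣ Sum.sum t
∣sum {k = zero}  t h = divides 0ℤ refl
∣sum {k = suc k} t h = ∣m∣n⇒∣m+n (h Fin.zero) (∣sum (t ∘ Fin.suc) (h ∘ Fin.suc))

-- Valuations and fractions.

+k≤m-n⇒k+n≤m : ∀ {k m n} → + k ℤ.≤ + m - + n → k ℕ.+ n ℕ.≤ m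
+k≤m-n⇒k+n≤m {k} {m} {n} h = ℤ.drop‿+≤+ (subst (ℤ._≤ + m) (sym (ℤ.pos-+ k n))
  (subst (λ y → + k + + n ℤ.≤ y) (lemma (+ m) (+ n)) (ℤ.+-monoˡ-≤ (+ n) h)))
  where
  lemma : ∀ m n → m - n + n ≡ m
  lemma = solve-∀

k+n≤m⇒+k≤m-n : ∀ {k m n} → k ℕ.+ n ℕ.≤ m → + k ℤ.≤ + m - + n
k+n≤m⇒+k≤m-n {k} {m} {n} h = subst (ℤ._≤ + m - + n) (lemma (+ k) (+ n))
  (ℤ.+-monoˡ-≤ (- + n) (subst (ℤ._≤ + m) (ℤ.pos-+ k n) (ℤ.+≤+ h)))
  where
  lemma : ∀ m n → m + n - n ≡ m
  lemma = solve-∀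

maxExponent-∣ : ∀ p m b → p ℕ.^ maxExponent p m b ℕ∣.∣ m
maxExponent-∣ p m zero    = ℕ∣.1∣ m
maxExponent-∣ p m (suc b) with p ℕ.^ suc b ∣? m
... | yes h = h
... | no  _ = maxExponent-∣ p m b

-- The search runs downwards from `b`, so its first hit is the largest one; after a miss at the top,
-- `k` still lies in the remaining range.
≤maxExponent : ∀ p m b {k} → k ℕ.≤ b → p ℕ.^ k ℕ∣.∣ m → k ℕ.≤ maxExponent p m b
≤maxExponent p m zero    k≤b h = k≤b
≤maxExponent p m (suc b) k≤b h with p ℕ.^ suc b ∣? m
... | yes _ = k≤b
... | no ∤m with ℕ.m≤n⇒m<n∨m≡n k≤b
...   | inj₁ k<sb = ≤maxExponent p m b (ℕ.s≤s⁻¹ k<sb) h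
...   | inj₂ refl = contradiction h ∤m

↥≢0 : ∀ {q} → q ℚᵘ.≄ 0ℚᵘ → ↥ q ≢ 0ℤ
↥≢0 {mkℚᵘ _ _} q≄0 refl = q≄0 (*≡* refl)

-- Cross-multiplication hides the sign normalisation of `_÷_`, which for negative `j` moves the sign
-- into the numerator.
quotient-* : ∀ i j (j≢0 : j ≢ 0ℤ) → ↥ quotient i j j≢0 * j ≡ i * ↧ quotient i j j≢0
quotient-* i (+ zero)  j≢0 = contradiction refl j≢0
quotient-* i (+ suc m) j≢0 = trans (cong (_* + suc m) (ℤ.*-identityʳ i))
  (cong (λ k → i * + suc k) (sym (ℕ.+-identityʳ m)))
quotient-* i -[1+ m ]  j≢0 = ℤ.*-assoc i (- 1ℤ) -[1+ m ]

-- q lies in p ^ k ℤ₍ₚ₎; unlike the valuation, this form is visibly additive.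
InIdeal : ℕ → ℕ → ℚᵘ → Set
InIdeal p k q = ∃[ c ] ∃[ d ] ¬ + p ∣ d × ↥ q * d ≡ (+ p) ^ k * c * ↧ q

InIdeal-resp-≃ : ∀ p k {q r} → q ≃ r → InIdeal p k q → InIdeal p k r
InIdeal-resp-≃ p k {q@record{}} {r@record{}} (*≡* eq) (c , d , p∤d , e) =
  c , d , p∤d , ℤ.*-cancelʳ-≡ _ _ (↧ q) (begin
    ↥ r * d * ↧ q            ≡⟨ lemma (↥ r) d (↧ q) ⟩
    ↥ r * ↧ q * d            ≡⟨ cong (_* d) eq ⟨
    ↥ q * ↧ r * d            ≡⟨ lemma (↥ q) (↧ r) d ⟩
    ↥ q * d * ↧ r            ≡⟨ cong (_* ↧ r) e ⟩
    P * c * ↧ q * ↧ r        ≡⟨ lemma (P * c) (↧ q) (↧ r) ⟩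
    P * c * ↧ r * ↧ q        ∎)
  where
  open ≡-Reasoning
  P = (+ p) ^ k
  lemma : ∀ x y z → x * y * z ≡ x * z * y
  lemma = solve-∀

-- Divisibility by a prime and its powers.

module _ {p : ℕ} (pr : Prime p) where

  private
    instance
      p≢0 : ℕ.NonZero p
      p≢0 = prime⇒nonZero pr
      p>1 : ℕ.NonTrivial p
      p>1 = prime⇒nonTrivial pr

  ∣*⇒∣⊎∣ : ∀ x y → + p ∣ x * y → (+ p ∣ x) ⊎ (+ p ∣ y)
  ∣*⇒∣⊎∣ x y h
    with euclidsLemma ∣ x ∣ ∣ y ∣ pr (subst (p ℕ∣.∣_) (ℤ.abs-* x y) (∣⇒∣ᵤ h))
  ... | inj₁ h = inj₁ (∣ᵤ⇒∣ h)
  ... | inj₂ h = inj₂ (∣ᵤ⇒∣ h)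

  ∤* : ∀ {x y} → ¬ + p ∣ x → ¬ + p ∣ y → ¬ + p ∣ x * y
  ∤* {x} {y} p∤x p∤y = [ p∤x , p∤y ]′ ∘ ∣*⇒∣⊎∣ x y

  ∤1 : ¬ + p ∣ 1ℤ
  ∤1 h = ℕ.<⇒≱ (ℕ.nonTrivial⇒n>1 p) (ℕ∣.∣⇒≤ (∣⇒∣ᵤ h))

  ∤⇒coprime : ∀ {m} → ¬ p ℕ∣.∣ m → Coprime p m
  ∤⇒coprime p∤m (d∣p , d∣m) with prime⇒irreducible pr d∣p
  ... | inj₁ refl = refl
  ... | inj₂ refl = contradiction d∣m p∤m

  -- As `p` is prime and does not divide `y`, the power `p ^ k` is coprime to `y`.
  ^∣*⇒^∣ : ∀ k x y → ¬ + p ∣ y → (+ p) ^ k ∣ x * y → (+ p) ^ k ∣ x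
  ^∣*⇒^∣ k x y p∤y h = subst (_∣ x) (pos-^ p k) (∣ᵤ⇒∣ (coprime-divisor
      (Coprime.sym (coprime-^ k (Coprime.sym (∤⇒coprime (p∤y ∘ ∣ᵤ⇒∣)))))
      (subst (p ℕ.^ k ℕ∣.∣_) (trans (ℤ.abs-* x y) (ℕ.*-comm ∣ x ∣ ∣ y ∣))
        (∣⇒∣ᵤ (subst (_∣ x * y) (sym (pos-^ p k)) h)))))

  -- Fermat's little theorem and Euler's theorem modulo prime powers.

  p∤k! : ∀ {k} → k ℕ.< p → ¬ p ℕ∣.∣ k ℕ.!
  p∤k! {zero}  k<p h = ℕ.<⇒≱ (ℕ.nonTrivial⇒n>1 p) (ℕ∣.∣⇒≤ h)
  p∤k! {suc k} k<p h with euclidsLemma (suc k) (k ℕ.!) pr h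
  ... | inj₁ h = ℕ.<⇒≱ k<p (ℕ∣.∣⇒≤ h)
  ... | inj₂ h = p∤k! (ℕ.<-trans (ℕ.n<1+n k) k<p) h

  -- `p` divides `p ! = (p C k) * (k ! * (p - k) !)` but neither factorial on the right, since `k`
  -- and `p - k` are both less than `p`.
  p∣pCk : ∀ {k} → 0 ℕ.< k → k ℕ.< p → p ℕ∣.∣ p C k
  p∣pCk {k} 0<k k<p with euclidsLemma (p C k) (k ℕ.! ℕ.* (p ∸ k) ℕ.!) pr p∣C*
    where
    instance
      _ = ℕ._!*_!≢0 k (p ∸ k)
    k≤p : k ℕ.≤ p
    k≤p = ℕ.<⇒≤ k<p
    m∣m! : ∀ m .{{_ : ℕ.NonZero m}} → m ℕ∣.∣ m ℕ.!
    m∣m! (suc m) = ℕ∣.m∣m*n (m ℕ.!)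
    p∣C* : p ℕ∣.∣ (p C k) ℕ.* (k ℕ.! ℕ.* (p ∸ k) ℕ.!)
    p∣C* = subst (p ℕ∣.∣_)
      (sym (trans (cong (ℕ._* (k ℕ.! ℕ.* (p ∸ k) ℕ.!)) (nCk≡n!/k![n-k]! k≤p)) (m/n*n≡m (k![n∸k]!∣n! k≤p))))
      (m∣m! p)
  ... | inj₁ h = h
  ... | inj₂ h with euclidsLemma (k ℕ.!) ((p ∸ k) ℕ.!) pr h
  ...   | inj₁ h = contradiction h (p∤k! k<p)
  ...   | inj₂ h = contradiction h (p∤k! (ℕ.∸-monoʳ-< 0<k (ℕ.<⇒≤ k<p)))

  ∣binomialTerm : ∀ x (k : Fin (suc p)) → 0 ℕ.< toℕ k → toℕ k ℕ.< p →
                  + p ∣ Binomial.binomialTerm x 1ℤ p k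
  ∣binomialTerm x k 0<k k<p = subst (+ p ∣_) (sym (×≡* (p C toℕ k) b))
    (∣m⇒∣m*n {m = + (p C toℕ k)} b (∣ᵤ⇒∣ (p∣pCk 0<k k<p)))
    where b = Binomial.binomial x 1ℤ p k

  -- In the binomial expansion the two extreme terms are `1` and `x ^ p`, and all the others are
  -- divisible by `p`.
  [x+1]^p≡x^p+1[mod-p] : ∀ x → + p ∣ (x + 1ℤ) ^ p - (x ^ p + 1ℤ)
  [x+1]^p≡x^p+1[mod-p] x = go p refl
    where
    one^ : ∀ k → 1ℤ Exp.^ k ≡ 1ℤ
    one^ k = trans (^≡^ 1ℤ k) (ℤ.^-zeroˡ k)
    -- Replacing `p` by `suc q` gives the sum the index set `Fin (suc (suc q))`, from which the
    -- first and last terms can be split off.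
    go : ∀ q → p ≡ q → + p ∣ (x + 1ℤ) ^ q - (x ^ q + 1ℤ)
    go zero    p≡q = contradiction p≡q (ℕ.≢-nonZero⁻¹ p)
    go (suc q) refl = subst (+ p ∣_) (sym diff) (∣sum mid ∣mid)
      where
      t : Vector ℤ (suc (suc q))
      t = Binomial.binomialTerm x 1ℤ p
      mid : Vector ℤ q
      mid i = t (inject₁ (Fin.suc i))
      ∣mid : ∀ i → + p ∣ mid i
      ∣mid i = ∣binomialTerm x (inject₁ (Fin.suc i)) ℕ.z<s
        (subst (λ k → suc k ℕ.< suc q) (sym (Fin.toℕ-inject₁ i)) (ℕ.s<s (Fin.toℕ<n i)))
      first : t Fin.zero ≡ 1ℤ
      first = trans (×≡* 1 _) (trans (ℤ.*-identityˡ _) (trans (ℤ.*-identityˡ _) (one^ p)))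
      last : t (fromℕ (suc q)) ≡ x ^ p
      last = begin
        t (fromℕ p)
          ≡⟨ ×≡* (p C toℕ (fromℕ p)) _ ⟩
        + (p C toℕ (fromℕ p)) * (x Exp.^ toℕ (fromℕ p) * 1ℤ Exp.^ (p ∸ toℕ (fromℕ p)))
          ≡⟨ cong₂ (λ k l → + (p C k) * (x Exp.^ k * l)) (Fin.toℕ-fromℕ p) (one^ (p ∸ toℕ (fromℕ p))) ⟩
        + (p C p) * (x Exp.^ p * 1ℤ)
          ≡⟨ cong₂ (λ k l → + k * l) (nCn≡1 p) (ℤ.*-identityʳ _) ⟩
        1ℤ * x Exp.^ p
          ≡⟨ ℤ.*-identityˡ _ ⟩
        x Exp.^ p
          ≡⟨ ^≡^ x p ⟩
        x ^ p ∎
        where open ≡-Reasoning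
      lemma : ∀ m y → 1ℤ + m + y - (y + 1ℤ) ≡ m
      lemma = solve-∀
      diff : (x + 1ℤ) ^ p - (x ^ p + 1ℤ) ≡ Sum.sum mid
      diff = begin
        (x + 1ℤ) ^ p - (x ^ p + 1ℤ)
          ≡⟨ cong (_- (x ^ p + 1ℤ)) (^≡^ (x + 1ℤ) p) ⟨
        (x + 1ℤ) Exp.^ p - (x ^ p + 1ℤ)
          ≡⟨ cong (_- (x ^ p + 1ℤ)) (Binomial.theorem p x 1ℤ) ⟩
        Sum.sum t - (x ^ p + 1ℤ)
          ≡⟨ cong (_- (x ^ p + 1ℤ)) (Sum.sum-init-last t) ⟩
        t Fin.zero + Sum.sum mid + t (fromℕ p) - (x ^ p + 1ℤ)
          ≡⟨ cong₂ (λ a b → a + Sum.sum mid + b - (x ^ p + 1ℤ)) first last ⟩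
        1ℤ + Sum.sum mid + x ^ p - (x ^ p + 1ℤ)
          ≡⟨ lemma (Sum.sum mid) (x ^ p) ⟩
        Sum.sum mid ∎
        where open ≡-Reasoning

  -- Reduce `x` to its remainder modulo `p`, a natural number, and use induction from `0` with the
  -- preceding congruence as the step.
  x^p≡x[mod-p] : ∀ x → + p ∣ x ^ p - x
  x^p≡x[mod-p] x = congr-trans (x ^ p) (congr-^ x p x≡r)
    (congr-trans ((+ r) ^ p) (nat r) (congr-sym x x≡r))
    where
    r = x %ℕ p
    q = x /ℕ p
    lemma : ∀ r q m → r + q * m - r ≡ q * m
    lemma = solve-∀
    x≡r : + p ∣ x - + r
    x≡r = divides q (trans (cong (_- + r) (a≡a%ℕn+[a/ℕn]*n x p)) (lemma (+ r) q (+ p)))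
    zero^ : ∀ q .{{_ : ℕ.NonZero q}} → 0ℤ ^ q ≡ 0ℤ
    zero^ (suc q) = refl
    shift : ∀ x y → y + 1ℤ - (x + 1ℤ) ≡ y - x
    shift = solve-∀
    nat : ∀ r → + p ∣ (+ r) ^ p - + r
    nat zero    = divides 0ℤ (cong (_- 0ℤ) (zero^ p))
    nat (suc r) = subst (λ y → + p ∣ y ^ p - y) (cong +_ (ℕ.+-comm r 1))
      (congr-trans ((+ r + 1ℤ) ^ p) ([x+1]^p≡x^p+1[mod-p] (+ r))
        (subst (+ p ∣_) (sym (shift (+ r) ((+ r) ^ p))) (nat r)))

  fermat : ∀ x → ¬ + p ∣ x → + p ∣ x ^ (p ∸ 1) - 1ℤ
  fermat x p∤x = [ (λ h → contradiction h p∤x) , id ]′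
    (∣*⇒∣⊎∣ x _ (subst (+ p ∣_) eq (x^p≡x[mod-p] x)))
    where
    lemma : ∀ x y → x * y - x ≡ x * (y - 1ℤ)
    lemma = solve-∀
    eq : x ^ p - x ≡ x * (x ^ (p ∸ 1) - 1ℤ)
    eq = trans (cong (λ k → x ^ k - x) (sym (ℕ.suc-pred p {{p≢0}}))) (lemma x (x ^ (p ∸ 1)))

  -- Induction on `k` from Fermat's theorem: raising `y ≡ 1` modulo `p ^ suc k` to the power `p`
  -- gains one more factor `p` in the modulus.
  euler : ∀ x → ¬ + p ∣ x → ∀ k → (+ p) ^ suc k ∣ x ^ ((p ∸ 1) ℕ.* p ℕ.^ k) - 1ℤ
  euler x p∤x zero    = subst₂ (λ m e → m ∣ x ^ e - 1ℤ) (sym (ℤ.*-identityʳ (+ p)))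
    (sym (ℕ.*-identityʳ (p ∸ 1))) (fermat x p∤x)
  euler x p∤x (suc k) =
    subst (λ y → (+ p) ^ suc (suc k) ∣ y - 1ℤ)
      (trans (ℤ.^-*-assoc x ((p ∸ 1) ℕ.* p ℕ.^ k) p)
        (cong (x ^_) (trans (ℕ.*-assoc (p ∸ 1) (p ℕ.^ k) p) (cong ((p ∸ 1) ℕ.*_) (ℕ.*-comm (p ℕ.^ k) p)))))
      (lift (x ^ ((p ∸ 1) ℕ.* p ℕ.^ k)) (euler x p∤x k))
    where
    P = (+ p) ^ k
    -- The binomial expansion to second order. With `j = p` and `t = y - 1` the linear term acquires
    -- the extra factor `p`.
    expand : ∀ t j → ∃[ e ] (1ℤ + t) ^ j ≡ 1ℤ + + j * t + t * t * e
    expand t zero    = 0ℤ , lemma t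
      where
      lemma : ∀ t → 1ℤ ≡ 1ℤ + 0ℤ * t + t * t * 0ℤ
      lemma = solve-∀
    expand t (suc j) = let e , eq = expand t j in
      + j + e + t * e , trans (cong ((1ℤ + t) *_) eq) (lemma t (+ j) e)
      where
      lemma : ∀ t j e → (1ℤ + t) * (1ℤ + j * t + t * t * e) ≡
                        1ℤ + (1ℤ + j) * t + t * t * (j + e + t * e)
      lemma = solve-∀
    -- The error term of expand is divisible by (p ^ suc k) ^ 2, hence by
    -- p ^ suc (suc k).
    lift : ∀ y → (+ p) ^ suc k ∣ y - 1ℤ → (+ p) ^ suc (suc k) ∣ y ^ p - 1ℤ
    lift y (divides q eq) with expand (y - 1ℤ) p
    ... | e , eq′ = divides (q + q * q * P * e) (begin
      y ^ p - 1ℤ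
        ≡⟨ cong (λ z → z ^ p - 1ℤ) (lemma₁ y) ⟩
      (1ℤ + (y - 1ℤ)) ^ p - 1ℤ
        ≡⟨ cong (_- 1ℤ) eq′ ⟩
      1ℤ + + p * (y - 1ℤ) + (y - 1ℤ) * (y - 1ℤ) * e - 1ℤ
        ≡⟨ cong (λ t → 1ℤ + + p * t + t * t * e - 1ℤ) eq ⟩
      1ℤ + + p * (q * (+ p * P)) + q * (+ p * P) * (q * (+ p * P)) * e - 1ℤ
        ≡⟨ lemma₂ (+ p) P q e ⟩
      (q + q * q * P * e) * (+ p * (+ p * P)) ∎)
      where
      open ≡-Reasoning
      lemma₁ : ∀ y → y ≡ 1ℤ + (y - 1ℤ)
      lemma₁ = solve-∀
      lemma₂ : ∀ p P q e → 1ℤ + p * (q * (p * P)) + q * (p * P) * (q * (p * P)) * e - 1ℤ ≡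
                           (q + q * q * P * e) * (p * (p * P))
      lemma₂ = solve-∀

  -- Roots of units modulo prime powers.

  ∤^ : ∀ x → ¬ + p ∣ x → ∀ k → ¬ + p ∣ x ^ k
  ∤^ x p∤x zero    = ∤1
  ∤^ x p∤x (suc k) = ∤* p∤x (∤^ x p∤x k)

  -- Units satisfy `x ^ E ≡ 1`, and `n` is coprime to `E`, so a Bézout coefficient `w` inverts `n`
  -- up to sign modulo `E`. Raising to the power `w` then extracts an `n`-th root, of an inverse if
  -- the sign is negative.
  ∃-nthRoot : ∀ {n} → gcd n (p ℕ.* (p ∸ 1)) ≡ 1 → ∀ M c d → ¬ + p ∣ c → ¬ + p ∣ d →
              ∃[ z ] (+ p) ^ M ∣ c - d * z ^ n
  ∃-nthRoot {n} gcd≡1 M c d p∤c p∤d = root (coprime-Bézout n⊥E)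
    where
    n⊥p*[p-1] = gcd≡1⇒coprime {n} gcd≡1
    E E-1 : ℕ
    -- The totient of `p ^ suc M` rather than of `p ^ M`, so that `M = 0` needs no separate case.
    E = (p ∸ 1) ℕ.* p ℕ.^ M
    E-1 = E ∸ 1
    instance
      E≢0 : ℕ.NonZero E
      E≢0 = ℕ.m*n≢0 (p ∸ 1) (p ℕ.^ M) {{ℕ.>-nonZero (ℕ.m<n⇒0<n∸m (ℕ.nonTrivial⇒n>1 p))}} {{ℕ.m^n≢0 p M}}
    n⊥E : Coprime n E
    n⊥E = coprime-* (λ (h , k) → n⊥p*[p-1] (h , ℕ∣.∣n⇒∣m*n p k))
                    (coprime-^ M (λ (h , k) → n⊥p*[p-1] (h , ℕ∣.∣m⇒∣m*n (p ∸ 1) k)))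
    x*x^E-1 : ∀ x → x * x ^ E-1 ≡ x ^ E
    x*x^E-1 x = cong (x ^_) (ℕ.suc-pred E)
    x^E≡1 : ∀ x → ¬ + p ∣ x → (+ p) ^ M ∣ x ^ E - 1ℤ
    x^E≡1 x p∤x = ∣ₛ.∣-trans (∣n⇒∣m*n (+ p) ∣ₛ.∣-refl) (euler x p∤x M)
    x^[l*E]≡1 : ∀ x → ¬ + p ∣ x → ∀ l → (+ p) ^ M ∣ x ^ (l ℕ.* E) - 1ℤ
    x^[l*E]≡1 x p∤x l = subst (λ y → (+ p) ^ M ∣ x ^ (l ℕ.* E) - y) (ℤ.^-zeroˡ l)
      (subst (λ y → (+ p) ^ M ∣ y - 1ℤ ^ l) (trans (ℤ.^-*-assoc x E l) (cong (x ^_) (ℕ.*-comm E l)))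
        (congr-^ (x ^ E) l (x^E≡1 x p∤x)))
    -- g is c / d in the first case and d / c in the second, with inverses
    -- modulo p ^ M expressed as (E - 1)-st powers.
    root : Bézout.Identity 1 n E → ∃[ z ] (+ p) ^ M ∣ c - d * z ^ n
    root (Bézout.+- w l eq) = g ^ w , congr-sym (d * (g ^ w) ^ n)
      (congr-trans (d * (g ^ w) ^ n) step₁ step₂)
      where
      g = c * d ^ E-1
      -- Here the Bézout relation reads `1 + l * E = w * n`.
      g^ : (g ^ w) ^ n ≡ g * g ^ (l ℕ.* E)
      g^ = trans (ℤ.^-*-assoc g w n) (cong (g ^_) (sym eq))
      step₁ : (+ p) ^ M ∣ d * (g ^ w) ^ n - d * (g * 1ℤ)
      step₁ = subst (λ y → (+ p) ^ M ∣ d * y - d * (g * 1ℤ)) (sym g^)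
        (congr-* d (g * g ^ (l ℕ.* E)) (congr-refl d)
          (congr-* g (g ^ (l ℕ.* E)) (congr-refl g)
            (x^[l*E]≡1 g (∤* p∤c (∤^ d p∤d E-1)) l)))
      lemma : ∀ c d e → c * (d * e) ≡ d * (c * e * 1ℤ)
      lemma = solve-∀
      step₂ : (+ p) ^ M ∣ d * (g * 1ℤ) - c
      step₂ = subst₂ (λ y z → (+ p) ^ M ∣ y - z)
        (trans (cong (c *_) (sym (x*x^E-1 d))) (lemma c d (d ^ E-1))) (ℤ.*-identityʳ c)
        (congr-* c (d ^ E) (congr-refl c) (x^E≡1 d p∤d))
    root (Bézout.-+ w l eq) = g ^ w , congr-trans c
      (congr-sym (c * (g * (g ^ w) ^ n)) step₁) step₂
      where
      g = d * c ^ E-1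
      -- Here it reads `1 + w * n = l * E`, so `(g ^ w) ^ n` is inverse to `g`.
      g^ : g * (g ^ w) ^ n ≡ g ^ (l ℕ.* E)
      g^ = trans (cong (g *_) (ℤ.^-*-assoc g w n)) (cong (g ^_) eq)
      step₁ : (+ p) ^ M ∣ c * (g * (g ^ w) ^ n) - c
      step₁ = subst₂ (λ y z → (+ p) ^ M ∣ c * y - z) (sym g^) (ℤ.*-identityʳ c)
        (congr-* c (g ^ (l ℕ.* E)) (congr-refl c) (x^[l*E]≡1 g (∤* p∤d (∤^ c p∤c E-1)) l))
      lemma : ∀ c d e z → c * e * (d * z) ≡ c * (d * e * z)
      lemma = solve-∀
      -- `c * g = d * c ^ E`, and `c ^ E ≡ 1`.
      step₂ : (+ p) ^ M ∣ c * (g * (g ^ w) ^ n) - d * (g ^ w) ^ n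
      step₂ = subst₂ (λ y z → (+ p) ^ M ∣ y - z)
        (trans (cong (_* (d * (g ^ w) ^ n)) (sym (x*x^E-1 c))) (lemma c d (c ^ E-1) ((g ^ w) ^ n)))
        (ℤ.*-identityˡ (d * (g ^ w) ^ n))
        (congr-* (c ^ E) (d * (g ^ w) ^ n) (x^E≡1 c p∤c) (congr-refl (d * (g ^ w) ^ n)))

  -- The valuation and membership in `p ^ k ℤ₍ₚ₎`.

  k<p^k : ∀ k → k ℕ.< p ℕ.^ k
  k<p^k zero    = ℕ.z<s
  k<p^k (suc k) = ℕ.<-≤-trans (ℕ.s<s (k<p^k k)) (begin
    suc (p ℕ.^ k)            ≤⟨ ℕ.+-monoˡ-≤ (p ℕ.^ k) (ℕ.m^n>0 p k) ⟩
    p ℕ.^ k ℕ.+ p ℕ.^ k      ≡⟨ cong (p ℕ.^ k ℕ.+_) (ℕ.+-identityʳ (p ℕ.^ k)) ⟨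
    2 ℕ.* p ℕ.^ k            ≤⟨ ℕ.*-monoˡ-≤ (p ℕ.^ k) (ℕ.nonTrivial⇒n>1 p) ⟩
    p ℕ.* p ℕ.^ k            ∎)
    where open ℕ.≤-Reasoning

  -- From `k < p ^ k ≤ ∣ i ∣`, the exponent `k` lies within the search range of `ν`.
  ^∣⇒≤ν : ∀ {i} k → i ≢ 0ℤ → (+ p) ^ k ∣ i → k ℕ.≤ ν p i
  ^∣⇒≤ν {i} k i≢0 h = ≤maxExponent p ∣ i ∣ ∣ i ∣ (ℕ.<⇒≤ (ℕ.<-≤-trans (k<p^k k) (ℕ∣.∣⇒≤ h′))) h′
    where
    instance
      ∣i∣≢0 : ℕ.NonZero ∣ i ∣
      ∣i∣≢0 = ℕ.≢-nonZero (i≢0 ∘ ℤ.∣i∣≡0⇒i≡0)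
    h′ : p ℕ.^ k ℕ∣.∣ ∣ i ∣
    h′ = ∣⇒∣ᵤ (subst (_∣ i) (sym (pos-^ p k)) h)

  -- If `p` divided the cofactor `u`, then `p ^ suc (ν p i)` would divide `i`, against the
  -- maximality of `ν p i`.
  factor : ∀ i → i ≢ 0ℤ → ∃[ u ] i ≡ (+ p) ^ ν p i * u × ¬ + p ∣ u
  factor i i≢0 with subst (_∣ i) (pos-^ p (ν p i)) (∣ᵤ⇒∣ (maxExponent-∣ p ∣ i ∣ ∣ i ∣))
  ... | divides u eq = u , trans eq (ℤ.*-comm u _) , λ (divides v u≡vp) →
    ℕ.<-irrefl refl (^∣⇒≤ν (suc (ν p i)) i≢0
      (divides v (trans eq (trans (cong (_* (+ p) ^ ν p i) u≡vp) (ℤ.*-assoc v (+ p) _)))))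

  -- The ultrametric inequality. Over a common denominator the witness `d * d′` stays prime to `p`
  -- because `p` is prime.
  InIdeal-+ : ∀ k q r → InIdeal p k q → InIdeal p k r → InIdeal p k (q ℚᵘ.+ r)
  InIdeal-+ k (mkℚᵘ a b) (mkℚᵘ a′ b′) (c , d , p∤d , e) (c′ , d′ , p∤d′ , e′) =
    c * d′ + c′ * d , d * d′ , ∤* p∤d p∤d′ , (begin
      (a * B′ + a′ * B) * (d * d′)
        ≡⟨ lemma₁ a B a′ B′ d d′ ⟩
      a * d * (B′ * d′) + a′ * d′ * (B * d)
        ≡⟨ cong₂ (λ x y → x * (B′ * d′) + y * (B * d)) e e′ ⟩
      P * c * B * (B′ * d′) + P * c′ * B′ * (B * d)
        ≡⟨ lemma₂ P c B c′ B′ d d′ ⟩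
      P * (c * d′ + c′ * d) * (B * B′)
        ≡⟨ cong (P * (c * d′ + c′ * d) *_) (ℤ.pos-* (suc b) (suc b′)) ⟨
      P * (c * d′ + c′ * d) * + (suc b ℕ.* suc b′) ∎)
    where
    open ≡-Reasoning
    P = (+ p) ^ k
    B = + suc b
    B′ = + suc b′
    lemma₁ : ∀ a b a′ b′ d d′ → (a * b′ + a′ * b) * (d * d′) ≡ a * d * (b′ * d′) + a′ * d′ * (b * d)
    lemma₁ = solve-∀
    lemma₂ : ∀ P c b c′ b′ d d′ → P * c * b * (b′ * d′) + P * c′ * b′ * (b * d) ≡
                                  P * (c * d′ + c′ * d) * (b * b′)
    lemma₂ = solve-∀

  ≤ν⇒InIdeal : ∀ k q → k ≤ν[ p ] q → InIdeal p k q
  ≤ν⇒InIdeal k q h with q ℚᵘ.≃? 0ℚᵘ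
  -- Zero has a junk valuation and is treated apart, with `c = 0`.
  ≤ν⇒InIdeal k q@record{} h | yes (*≡* eq) = 0ℤ , 1ℤ , ∤1 ,
    trans eq (sym (cong (_* ↧ q) (ℤ.*-zeroʳ ((+ p) ^ k))))
  ≤ν⇒InIdeal k q@record{} h | no q≄0
    with factor (↥ q) (↥≢0 q≄0) | factor (↧ q) (λ ())
  ... | u , a≡ , _ | w , b≡ , p∤w = (+ p) ^ e * u , w , p∤w , (begin
      ↥ q * w                          ≡⟨ cong (_* w) a≡ ⟩
      (+ p) ^ ν p (↥ q) * u * w        ≡⟨ cong (λ k → (+ p) ^ k * u * w) (sym (ℕ.m+[n∸m]≡n k+β≤α)) ⟩
      (+ p) ^ (k ℕ.+ β ℕ.+ e) * u * w  ≡⟨ cong (λ x → x * u * w) (ℤ.^-distribˡ-+-* (+ p) (k ℕ.+ β) e) ⟩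
      (+ p) ^ (k ℕ.+ β) * (+ p) ^ e * u * w
        ≡⟨ cong (λ x → x * (+ p) ^ e * u * w) (ℤ.^-distribˡ-+-* (+ p) k β) ⟩
      (+ p) ^ k * (+ p) ^ β * (+ p) ^ e * u * w
        ≡⟨ lemma ((+ p) ^ k) ((+ p) ^ β) ((+ p) ^ e) u w ⟩
      (+ p) ^ k * ((+ p) ^ e * u) * ((+ p) ^ β * w)
        ≡⟨ cong ((+ p) ^ k * ((+ p) ^ e * u) *_) b≡ ⟨
      (+ p) ^ k * ((+ p) ^ e * u) * ↧ q ∎)
    where
    open ≡-Reasoning
    β = ν p (↧ q)
    k+β≤α : k ℕ.+ β ℕ.≤ ν p (↥ q)
    k+β≤α = +k≤m-n⇒k+n≤m (h q≄0)
    e = ν p (↥ q) ∸ (k ℕ.+ β)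
    lemma : ∀ k b e u w → k * b * e * u * w ≡ k * (e * u) * (b * w)
    lemma = solve-∀

  -- The factor `p ^ β` of the denominator joins `p ^ k`, so `p ^ (k + β)` divides `↥ q * d`; since
  -- `p` does not divide `d`, it divides `↥ q`.
  InIdeal⇒≤ν : ∀ k q → InIdeal p k q → k ≤ν[ p ] q
  InIdeal⇒≤ν k q@record{} (c , d , p∤d , e) q≄0 with factor (↧ q) (λ ())
  ... | w , b≡ , p∤w = k+n≤m⇒+k≤m-n (^∣⇒≤ν (k ℕ.+ β) (↥≢0 q≄0)
    (^∣*⇒^∣ (k ℕ.+ β) (↥ q) d p∤d (divides (c * w) (begin
      ↥ q * d                              ≡⟨ e ⟩
      (+ p) ^ k * c * ↧ q                  ≡⟨ cong ((+ p) ^ k * c *_) b≡ ⟩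
      (+ p) ^ k * c * ((+ p) ^ β * w)      ≡⟨ lemma ((+ p) ^ k) ((+ p) ^ β) c w ⟩
      c * w * ((+ p) ^ k * (+ p) ^ β)      ≡⟨ cong (c * w *_) (ℤ.^-distribˡ-+-* (+ p) k β) ⟨
      c * w * (+ p) ^ (k ℕ.+ β)            ∎))))
    where
    open ≡-Reasoning
    β = ν p (↧ q)
    lemma : ∀ k b c w → k * c * (b * w) ≡ c * w * (k * b)
    lemma = solve-∀

  -- Reduces closeness to `i / j` to an integer identity, as `q - i / j` equals
  -- `(↥ q * j - i * ↧ q) / (↧ q * j)`.
  InIdeal-quotient : ∀ k q i j (j≢0 : j ≢ 0ℤ) c d → ¬ + p ∣ d →
    (↥ q * j - i * ↧ q) * d ≡ (+ p) ^ k * c * (↧ q * j) →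
    InIdeal p k (q ℚᵘ.- quotient i j j≢0)
  InIdeal-quotient k q i j j≢0 c d p∤d = go q (quotient i j j≢0) (quotient-* i j j≢0)
    where
    instance
      _ = ℤ.≢-nonZero j≢0
    -- Generalising the quotient to any `r` with the same cross-multiplied equation avoids its
    -- normal form.
    go : ∀ q r → ↥ r * j ≡ i * ↧ r →
         (↥ q * j - i * ↧ q) * d ≡ (+ p) ^ k * c * (↧ q * j) → InIdeal p k (q ℚᵘ.- r)
    go (mkℚᵘ a b) (mkℚᵘ a′ b′) r≡ e = c , d , p∤d , ℤ.*-cancelʳ-≡ _ _ j (begin
      (a * B′ + (- a′) * B) * d * j
        ≡⟨ lemma₁ a B a′ B′ d j ⟩
      (a * j * B′ - a′ * j * B) * d
        ≡⟨ cong (λ x → (a * j * B′ - x * B) * d) r≡ ⟩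
      (a * j * B′ - i * B′ * B) * d
        ≡⟨ lemma₂ a i B B′ d j ⟩
      (a * j - i * B) * d * B′
        ≡⟨ cong (_* B′) e ⟩
      (+ p) ^ k * c * (B * j) * B′
        ≡⟨ lemma₃ ((+ p) ^ k * c) B B′ j ⟩
      (+ p) ^ k * c * (B * B′) * j
        ≡⟨ cong (λ x → (+ p) ^ k * c * x * j) (ℤ.pos-* (suc b) (suc b′)) ⟨
      (+ p) ^ k * c * + (suc b ℕ.* suc b′) * j ∎)
      where
      open ≡-Reasoning
      B = + suc b
      B′ = + suc b′
      lemma₁ : ∀ a b a′ b′ d j → (a * b′ + (- a′) * b) * d * j ≡ (a * j * b′ - a′ * j * b) * d
      lemma₁ = solve-∀
      lemma₂ : ∀ a i b b′ d j → (a * j * b′ - i * b′ * b) * d ≡ (a * j - i * b) * d * b′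
      lemma₂ = solve-∀
      lemma₃ : ∀ m b b′ j → m * (b * j) * b′ ≡ m * (b * b′) * j
      lemma₃ = solve-∀

-- Pigeonhole for residues modulo `n`.

splitAt-injective : ∀ m {n} (k l : Fin (m ℕ.+ n)) → Fin.splitAt m k ≡ Fin.splitAt m l → k ≡ l
splitAt-injective m {n} k l eq =
  trans (sym (Fin.join-splitAt m n k)) (trans (cong (Fin.join m n) eq) (Fin.join-splitAt m n l))

-- Two copies of `Fin r` do not fit into `Fin n`; by injectivity a collision cannot occur within one
-- copy.
images-meet : ∀ {n r} → n ℕ.< 2 ℕ.* r → (f g : Fin r → Fin n) →
              (∀ {i j} → f i ≡ f j → i ≡ j) → (∀ {i j} → g i ≡ g j → i ≡ j) →
              ∃₂ λ i j → f i ≡ g j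
images-meet {n} {r} n<2r f g f-inj g-inj
  with Fin.pigeonhole (subst (n ℕ.<_) (cong (r ℕ.+_) (ℕ.+-identityʳ r)) n<2r) ([ f , g ]′ ∘ Fin.splitAt r)
... | k , l , k<l , eq = go (Fin.splitAt r k) (Fin.splitAt r l) refl refl eq
  where
  k≢l : k ≢ l
  k≢l k≡l = ℕ.<-irrefl (cong toℕ k≡l) k<l
  go : ∀ s t → Fin.splitAt r k ≡ s → Fin.splitAt r l ≡ t → [ f , g ]′ s ≡ [ f , g ]′ t →
       ∃₂ λ i j → f i ≡ g j
  go (inj₁ i) (inj₂ j) _ _ eq = i , j , eq
  go (inj₂ j) (inj₁ i) _ _ eq = i , j , sym eq
  go (inj₁ i) (inj₁ j) s t eq =
    contradiction (splitAt-injective r k l (trans s (trans (cong inj₁ (f-inj eq)) (sym t)))) k≢l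
  go (inj₂ i) (inj₂ j) s t eq =
    contradiction (splitAt-injective r k l (trans s (trans (cong inj₂ (g-inj eq)) (sym t)))) k≢l

-- Each side receives the other's multiple of `n`, so both shifts are natural numbers and can later
-- serve as exponents of `p`.
%≡%⇒+*≡+* : ∀ x y n .{{_ : ℕ.NonZero n}} → x % n ≡ y % n →
            x ℕ.+ (y / n) ℕ.* n ≡ y ℕ.+ (x / n) ℕ.* n
%≡%⇒+*≡+* x y n eq = begin
  x ℕ.+ y / n ℕ.* n                          ≡⟨ cong (ℕ._+ y / n ℕ.* n) (m≡m%n+[m/n]*n x n) ⟩
  x % n ℕ.+ x / n ℕ.* n ℕ.+ y / n ℕ.* n      ≡⟨ cong (λ z → z ℕ.+ x / n ℕ.* n ℕ.+ y / n ℕ.* n) eq ⟩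
  y % n ℕ.+ x / n ℕ.* n ℕ.+ y / n ℕ.* n      ≡⟨ ℕ.+-assoc (y % n) _ _ ⟩
  y % n ℕ.+ (x / n ℕ.* n ℕ.+ y / n ℕ.* n)    ≡⟨ cong (y % n ℕ.+_) (ℕ.+-comm (x / n ℕ.* n) _) ⟩
  y % n ℕ.+ (y / n ℕ.* n ℕ.+ x / n ℕ.* n)    ≡⟨ ℕ.+-assoc (y % n) _ _ ⟨
  y % n ℕ.+ y / n ℕ.* n ℕ.+ x / n ℕ.* n      ≡⟨ cong (ℕ._+ x / n ℕ.* n) (m≡m%n+[m/n]*n y n) ⟨
  y ℕ.+ x / n ℕ.* n                          ∎
  where open ≡-Reasoning

%≡%⇒≡[mod] : ∀ u v c n .{{_ : ℕ.NonZero n}} → (u ℕ.+ c) % n ≡ (v ℕ.+ c) % n →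
             + u ≡ + v [mod n ]
%≡%⇒≡[mod] u v c n eq = ∣⇒∣ᵤ (divides (+ s - + t) (begin
  + u - + v
    ≡⟨ lemma₁ (+ u) (+ v) (+ c) (+ (t ℕ.* n)) ⟩
  + u + + c + + (t ℕ.* n) - (+ v + + c + + (t ℕ.* n))
    ≡⟨ cong (λ x → + x - (+ v + + c + + (t ℕ.* n))) (%≡%⇒+*≡+* (u ℕ.+ c) (v ℕ.+ c) n eq) ⟩
  + v + + c + + (s ℕ.* n) - (+ v + + c + + (t ℕ.* n))
    ≡⟨ lemma₂ (+ v) (+ c) (+ (s ℕ.* n)) (+ (t ℕ.* n)) ⟩
  + (s ℕ.* n) - + (t ℕ.* n)
    ≡⟨ cong₂ _-_ (ℤ.pos-* s n) (ℤ.pos-* t n) ⟩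
  + s * + n - + t * + n
    ≡⟨ lemma₃ (+ s) (+ t) (+ n) ⟩
  (+ s - + t) * + n ∎))
  where
  open ≡-Reasoning
  s = (u ℕ.+ c) / n
  t = (v ℕ.+ c) / n
  lemma₁ : ∀ u v c x → u - v ≡ u + c + x - (v + c + x)
  lemma₁ = solve-∀
  lemma₂ : ∀ v c x y → v + c + x - (v + c + y) ≡ x - y
  lemma₂ = solve-∀
  lemma₃ : ∀ s t n → s * n - t * n ≡ (s - t) * n
  lemma₃ = solve-∀

residue : ∀ n .{{_ : ℕ.NonZero n}} → ℕ → Fin n
residue n x = Fin.fromℕ< (m%n<n x n)

residue≡⇒%≡% : ∀ n .{{_ : ℕ.NonZero n}} x y → residue n x ≡ residue n y → x % n ≡ y % n
residue≡⇒%≡% n x y = Fin.fromℕ<-injective (x % n) (y % n) (m%n<n x n) (m%n<n y n)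

-- The maps sending `i` to `v i + β` and to `v i + α` modulo `n` are both injective because the
-- residues of `v` are distinct, so their images meet.
∃-congruent-shift : ∀ {n r} .{{_ : ℕ.NonZero n}} → n ℕ.< 2 ℕ.* r → (v : Fin r → ℕ) →
  (∀ i j → i Fin.< j → ¬ (+ v i ≡ + v j [mod n ])) → ∀ β α →
  ∃[ i ] ∃[ j ] ∃[ s ] ∃[ t ] v i ℕ.+ β ℕ.+ s ℕ.* n ≡ v j ℕ.+ α ℕ.+ t ℕ.* n
∃-congruent-shift {n} n<2r v v-distinct β α
  with images-meet n<2r (λ i → residue n (v i ℕ.+ β)) (λ i → residue n (v i ℕ.+ α)) (injective β) (injective α)
  where
  injective : ∀ c {i j} → residue n (v i ℕ.+ c) ≡ residue n (v j ℕ.+ c) → i ≡ j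
  injective c {i} {j} eq with Fin.<-cmp i j
  ... | tri< i<j _ _ = contradiction (%≡%⇒≡[mod] (v i) (v j) c n (residue≡⇒%≡% n _ _ eq)) (v-distinct i j i<j)
  ... | tri≈ _ i≡j _ = i≡j
  ... | tri> _ _ j<i = contradiction (%≡%⇒≡[mod] (v j) (v i) c n (residue≡⇒%≡% n _ _ (sym eq))) (v-distinct j i j<i)
... | i , j , eq = i , j , (v j ℕ.+ α) / n , (v i ℕ.+ β) / n ,
  %≡%⇒+*≡+* (v i ℕ.+ β) (v j ℕ.+ α) n (residue≡⇒%≡% n _ _ eq)

-- Diagonal forms at multiples of coordinate vectors.

∏≢0⇒≢0 : ∀ {r} (a : Vector ℤ r) → ∏ a ≢ 0ℤ → ∀ i → a i ≢ 0ℤ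
∏≢0⇒≢0 a ∏≢0 Fin.zero    a₀≡0 = ∏≢0 (cong (_* ∏ (a ∘ Fin.suc)) a₀≡0)
∏≢0⇒≢0 a ∏≢0 (Fin.suc i) = ∏≢0⇒≢0 (a ∘ Fin.suc)
  (λ ∏≡0 → ∏≢0 (trans (cong (a Fin.zero *_) ∏≡0) (ℤ.*-zeroʳ (a Fin.zero)))) i

single : ∀ {r} → Fin r → ℤ → Vector ℤ r
single Fin.zero    x = x ∷ replicate _ 0ℤ
single (Fin.suc i) x = 0ℤ ∷ single i x

module _ {n : ℕ} .{{_ : ℕ.NonZero n}} where

  *0^≡0 : ∀ a → a * 0ℤ ^ n ≡ 0ℤ
  *0^≡0 a = trans (cong (λ k → a * 0ℤ ^ k) (sym (ℕ.suc-pred n))) (ℤ.*-zeroʳ a)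

  diagonalForm-0 : ∀ {r} (a : Vector ℤ r) → diagonalForm n a (replicate r 0ℤ) ≡ 0ℤ
  diagonalForm-0 {zero}  a = refl
  diagonalForm-0 {suc r} a = cong₂ _+_ (*0^≡0 (a Fin.zero)) (diagonalForm-0 (a ∘ Fin.suc))

  diagonalForm-single : ∀ {r} (a : Vector ℤ r) i x → diagonalForm n a (single i x) ≡ a i * x ^ n
  diagonalForm-single a Fin.zero    x =
    trans (cong (λ z → a Fin.zero * x ^ n + z) (diagonalForm-0 (a ∘ Fin.suc))) (ℤ.+-identityʳ _)
  diagonalForm-single a (Fin.suc i) x =
    trans (cong₂ _+_ (*0^≡0 (a Fin.zero)) (diagonalForm-single (a ∘ Fin.suc) i x)) (ℤ.+-identityˡ _)

*≢0 : ∀ {i j} → i ≢ 0ℤ → j ≢ 0ℤ → i * j ≢ 0ℤ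
*≢0 {i} i≢0 j≢0 ij≡0 = [ i≢0 , j≢0 ]′ (ℤ.i*j≡0⇒i≡0∨j≡0 i ij≡0)

-- Approximation of rationals by ratios of monomials.

module _ {n p r : ℕ} (a : Vector ℤ r) .{{_ : ℕ.NonZero n}} (pr : Prime p)
  (gcd≡1 : gcd n (p ℕ.* (p ∸ 1)) ≡ 1) (n<2r : n ℕ.< 2 ℕ.* r) (∏a≢0 : ∏ a ≢ 0ℤ)
  (distinct : ∀ (i j : Fin r) → i Fin.< j → ¬ (+ ν p (a i) ≡ + ν p (a j) [mod n ])) where

  private
    F : Vector ℤ r → ℤ
    F = diagonalForm n a

    p≢0 : + p ≢ 0ℤ
    p≢0 p≡0 = ℕ.≢-nonZero⁻¹ p {{prime⇒nonZero pr}} (ℤ.+-injective p≡0)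

    a≢0 : ∀ i → a i ≢ 0ℤ
    a≢0 = ∏≢0⇒≢0 a ∏a≢0

  Approximable : ℕ → ℚᵘ → Set
  Approximable k q = ∃[ x ] ∃[ y ] ∃[ Fy≢0 ] InIdeal p k (q ℚᵘ.- quotient (F x) (F y) Fy≢0)

  -- On vectors supported at `i` and `j` the ratio of values of `F` is
  -- `a i * x ^ n / (a j * y ^ n)`, leaving one integer identity to verify.
  approximable-by-monomials : ∀ k q i j x y → y ≢ 0ℤ → ∀ c d → ¬ + p ∣ d →
    (↥ q * (a j * y ^ n) - a i * x ^ n * ↧ q) * d ≡ (+ p) ^ k * c * (↧ q * (a j * y ^ n)) →
    Approximable k q
  approximable-by-monomials k q i j x y y≢0 c d p∤d eq = single i x , single j y , Fy≢0 ,
    InIdeal-quotient pr k q (F (single i x)) (F (single j y)) Fy≢0 c d p∤d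
      (subst₂ (λ u v → (↥ q * v - u * ↧ q) * d ≡ (+ p) ^ k * c * (↧ q * v))
        (sym (diagonalForm-single a i x)) (sym (diagonalForm-single a j y)) eq)
    where
    Fy≢0 : F (single j y) ≢ 0ℤ
    Fy≢0 F≡0 = *≢0 (a≢0 j) (y≢0 ∘ ℤ.i^n≡0⇒i≡0 y n) (trans (sym (diagonalForm-single a j y)) F≡0)

  -- Let `A`, `B`, `U`, `V` be the parts prime to `p` of `↥ q`, `↧ q`, `a i`, `a j`. With
  -- `x = p ^ s * z` and `y = p ^ t`, the exponents `s` and `t` balance the powers of `p`, and
  -- `z ^ n ≡ A V / (B U)` matches the unit parts.
  approximable : ∀ k q → Approximable k q
  approximable k q with ↥ q ℤ.≟ 0ℤ
  ... | yes q≡0 = approximable-by-monomials k q i i 0ℤ 1ℤ (λ ()) 0ℤ 1ℤ (∤1 pr) (begin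
      (↥ q * (a i * 1ℤ ^ n) - a i * 0ℤ ^ n * ↧ q) * 1ℤ
        ≡⟨ cong₂ (λ u v → (u * (a i * 1ℤ ^ n) - v * ↧ q) * 1ℤ) q≡0 (*0^≡0 {n} (a i)) ⟩
      (0ℤ * (a i * 1ℤ ^ n) - 0ℤ * ↧ q) * 1ℤ
        ≡⟨ lemma (a i * 1ℤ ^ n) (↧ q) ((+ p) ^ k) ⟩
      (+ p) ^ k * 0ℤ * (↧ q * (a i * 1ℤ ^ n)) ∎)
    where
    open ≡-Reasoning
    i : Fin r
    -- Any index serves; one exists since `n < 2 r` forces `r > 0`.
    i = proj₁ (∃-congruent-shift n<2r (ν p ∘ a) distinct 0 0)
    lemma : ∀ x y z → (0ℤ * x - 0ℤ * y) * 1ℤ ≡ z * 0ℤ * (y * x)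
    lemma = solve-∀
  ... | no q≢0
    with factor pr (↥ q) q≢0 | factor pr (↧ q) (↧≢0 q)
    where
    ↧≢0 : ∀ q → ↧ q ≢ 0ℤ
    ↧≢0 (mkℚᵘ _ _) ()
  ... | A , ↥q≡ , p∤A | B , ↧q≡ , p∤B
    with ∃-congruent-shift n<2r (ν p ∘ a) distinct (ν p (↧ q)) (ν p (↥ q))
  ... | i , j , s , t , vi+β+sn≡vj+α+tn
    with factor pr (a i) (a≢0 i) | factor pr (a j) (a≢0 j)
  ... | U , ai≡ , p∤U | V , aj≡ , p∤V
    -- The extra precision `ν p (↧ q)` pays for the power of `p` in the factor `↧ q` on the right of
    -- the required identity.
    with ∃-nthRoot pr {n} gcd≡1 (k ℕ.+ ν p (↧ q)) (A * V) (B * U) (∤* pr p∤A p∤V) (∤* pr p∤B p∤U)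
  ... | z , divides c AV-BUz^n≡ =
    approximable-by-monomials k q i j ((+ p) ^ s * z) ((+ p) ^ t) (p≢0 ∘ ℤ.i^n≡0⇒i≡0 (+ p) t)
      -- `B * V` supplies the unit parts of `↧ q` and `a j` on the right; `Pα` is what remains of
      -- the common power of `p`.
      (c * Pα) (B * V) (∤* pr p∤B p∤V) (begin
      (↥ q * (a j * ((+ p) ^ t) ^ n) - a i * ((+ p) ^ s * z) ^ n * ↧ q) * (B * V)
        ≡⟨ cong₂ (λ x y → (↥ q * (a j * x) - a i * y * ↧ q) * (B * V)) Y^n X^n ⟩
      (↥ q * (a j * T) - a i * (S * z ^ n) * ↧ q) * (B * V)
        ≡⟨ cong₂ (λ x y → (x * (a j * T) - a i * (S * z ^ n) * y) * (B * V)) ↥q≡ ↧q≡ ⟩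
      (Pα * A * (a j * T) - a i * (S * z ^ n) * (Pβ * B)) * (B * V)
        ≡⟨ cong₂ (λ x y → (Pα * A * (y * T) - x * (S * z ^ n) * (Pβ * B)) * (B * V)) ai≡ aj≡ ⟩
      (Pα * A * (Pj * V * T) - Pi * U * (S * z ^ n) * (Pβ * B)) * (B * V)
        ≡⟨ lemma₁ Pα A Pj V T Pi U S (z ^ n) Pβ B ⟩
      (Pj * Pα * T * (A * V) - Pi * Pβ * S * (B * U * z ^ n)) * (B * V)
        ≡⟨ cong (λ x → (Pj * Pα * T * (A * V) - x * (B * U * z ^ n)) * (B * V)) powers ⟩
      (Pj * Pα * T * (A * V) - Pj * Pα * T * (B * U * z ^ n)) * (B * V)
        ≡⟨ lemma₂ (Pj * Pα * T) (A * V) (B * U * z ^ n) (B * V) ⟩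
      Pj * Pα * T * (A * V - B * U * z ^ n) * (B * V)
        ≡⟨ cong (λ x → Pj * Pα * T * x * (B * V)) AV-BUz^n≡ ⟩
      Pj * Pα * T * (c * (+ p) ^ (k ℕ.+ ν p (↧ q))) * (B * V)
        ≡⟨ cong (λ x → Pj * Pα * T * (c * x) * (B * V)) (ℤ.^-distribˡ-+-* (+ p) k (ν p (↧ q))) ⟩
      Pj * Pα * T * (c * ((+ p) ^ k * Pβ)) * (B * V)
        ≡⟨ lemma₃ Pj Pα T c ((+ p) ^ k) Pβ B V ⟩
      (+ p) ^ k * (c * Pα) * (Pβ * B * (Pj * V * T))
        ≡⟨ cong₂ (λ x y → (+ p) ^ k * (c * Pα) * (x * (y * T))) ↧q≡ aj≡ ⟨
      (+ p) ^ k * (c * Pα) * (↧ q * (a j * T))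
        ≡⟨ cong (λ x → (+ p) ^ k * (c * Pα) * (↧ q * (a j * x))) Y^n ⟨
      (+ p) ^ k * (c * Pα) * (↧ q * (a j * ((+ p) ^ t) ^ n)) ∎)
    where
    open ≡-Reasoning
    Pα = (+ p) ^ ν p (↥ q)
    Pβ = (+ p) ^ ν p (↧ q)
    Pi = (+ p) ^ ν p (a i)
    Pj = (+ p) ^ ν p (a j)
    S = (+ p) ^ (s ℕ.* n)
    T = (+ p) ^ (t ℕ.* n)
    Y^n : ((+ p) ^ t) ^ n ≡ T
    Y^n = ℤ.^-*-assoc (+ p) t n
    X^n : ((+ p) ^ s * z) ^ n ≡ S * z ^ n
    X^n = trans (^-distribʳ-* ((+ p) ^ s) z n) (cong (_* z ^ n) (ℤ.^-*-assoc (+ p) s n))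
    ^-+-+ : ∀ x y z → (+ p) ^ (x ℕ.+ y ℕ.+ z) ≡ (+ p) ^ x * (+ p) ^ y * (+ p) ^ z
    ^-+-+ x y z = trans (ℤ.^-distribˡ-+-* (+ p) (x ℕ.+ y) z)
      (cong (_* (+ p) ^ z) (ℤ.^-distribˡ-+-* (+ p) x y))
    powers : Pi * Pβ * S ≡ Pj * Pα * T
    powers = trans (sym (^-+-+ (ν p (a i)) (ν p (↧ q)) (s ℕ.* n)))
      (trans (cong ((+ p) ^_) vi+β+sn≡vj+α+tn) (^-+-+ (ν p (a j)) (ν p (↥ q)) (t ℕ.* n)))
    lemma₁ : ∀ α A j V T i U S W β B →
      (α * A * (j * V * T) - i * U * (S * W) * (β * B)) * (B * V) ≡
      (j * α * T * (A * V) - i * β * S * (B * U * W)) * (B * V)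
    lemma₁ = solve-∀
    lemma₂ : ∀ e x y d → (e * x - e * y) * d ≡ e * (x - y) * d
    lemma₂ = solve-∀
    lemma₃ : ∀ j α T c k β B V → j * α * T * (c * (k * β)) * (B * V) ≡
      k * (c * α) * (β * B * (j * V * T))
    lemma₃ = solve-∀

-- From rational to `p`-adic targets.

telescope : ∀ x y z → (x ℚᵘ.- y) ℚᵘ.+ (y ℚᵘ.- z) ≃ x ℚᵘ.- z
telescope x y z = begin
  x ℚᵘ.- y ℚᵘ.+ (y ℚᵘ.- z)            ≈⟨ ℚᵘ.+-assoc x (ℚᵘ.- y) (y ℚᵘ.- z) ⟩
  x ℚᵘ.+ (ℚᵘ.- y ℚᵘ.+ (y ℚᵘ.- z))     ≈⟨ ℚᵘ.+-congʳ x (ℚᵘ.≃-sym (ℚᵘ.+-assoc (ℚᵘ.- y) y (ℚᵘ.- z))) ⟩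
  x ℚᵘ.+ (ℚᵘ.- y ℚᵘ.+ y ℚᵘ.- z)       ≈⟨ ℚᵘ.+-congʳ x (ℚᵘ.+-congˡ (ℚᵘ.- z) (ℚᵘ.+-inverseˡ y)) ⟩
  x ℚᵘ.+ (0ℚᵘ ℚᵘ.- z)                 ≈⟨ ℚᵘ.+-congʳ x (ℚᵘ.+-identityˡ (ℚᵘ.- z)) ⟩
  x ℚᵘ.- z                            ∎
  where open ℚᵘ.≃-Reasoning

theorem1p3 :
    ∀ (n p r : ℕ) (a : Vector ℤ r) →
    3 ℕ.≤ n →
    Prime p →
    gcd n (p ℕ.* (p ∸ 1)) ≡ 1 →
    n ℕ.< 2 ℕ.* r →
    ∏ a ≢ 0ℤ →
    (∀ (i j : Fin r) → i Fin.< j → ¬ (+ ν p (a i) ≡ + ν p (a j) [mod n ])) →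
    DenseInℚₚ p (R p (diagonalForm n a))
theorem1p3 n@(suc _) p r a _ pr gcd≡1 n<2r ∏a≢0 distinct α k
  with cauchy α k
... | N , close
  with approximable a pr gcd≡1 n<2r ∏a≢0 distinct k (seq α N)
... | x , y , Fy≢0 , near = ι p s ,
  -- The element is the constant sequence at the ratio itself, so all differences vanish and their
  -- valuation bounds are vacuous.
  (x , y , Fy≢0 , λ _ → 0 , λ _ _ s-s≄0 → contradiction (ℚᵘ.+-inverseʳ s) s-s≄0) ,
  -- The Cauchy error and the approximation error both lie in `p ^ k ℤ₍ₚ₎`, hence so does their sum,
  -- with no loss of precision.
  N , λ m N≤m → InIdeal⇒≤ν pr k (seq α m ℚᵘ.- s)
    (InIdeal-resp-≃ p k (telescope (seq α m) (seq α N) s)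
      (InIdeal-+ pr k (seq α m ℚᵘ.- seq α N) (seq α N ℚᵘ.- s)
        (≤ν⇒InIdeal pr k (seq α m ℚᵘ.- seq α N) (close m N N≤m ℕ.≤-refl)) near))
  where
  s = quotient (diagonalForm n a x) (diagonalForm n a y) Fy≢0
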